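{- Let $G$ be a countably infinite discrete group and let $X$ be a Borel $G$-space. If $X$ admits a Borel weakly wandering complete section, then $X$ admits a $3$-generator.
   Context: A Borel $G$-space is a standard Borel space $X$ equipped with a Borel action of $G$. A complete section is a subset of $X$ meeting every orbit. A set $A\subseteq X$ is weakly wandering if there is an infinite $H\subseteq G$ such that $hA\cap h'A=\emptyset$ for all distinct $h,h'\in H$. A $k$-generator for $X$ is a partition $\{A_n\}_{n<k}$ of $X$ into Borel sets (pieces may be empty) such that $\{gA_n : g\in G, n<k\}$ generates the Borel $\sigma$-algebra of $X$. -}

module Defs where

open import Algebra.Bundles using (Group)
open import Data.Fin using (Fin)
open import Data.List using (List)
open import Data.List.Relation.Unary.Any using (Any)
open import Data.Nat as ℕ using (ℕ)
open import Data.Product using (Σ-syntax; ∃; ∃-syntax; _×_; _,_; uncurry)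
open import Data.Rational as ℚ using (ℚ)
import Data.Rational.Properties as ℚ
open import Data.Unit.Polymorphic using (⊤)
open import Function.Bundles using (_⇔_; Bijection)
open import Function.Metric.Structures using (IsGeneralMetric)
open import Level using (Level; 0ℓ; suc; _⊔_)
open import Relation.Binary.Core using (Rel)
open import Relation.Binary.Definitions using (_Respects_)
open import Relation.Binary.PropositionalEquality using (_≡_; _≢_; refl; setoid; subst; sym)
open import Relation.Nullary using (¬_; contradiction; yes; no)
open import Relation.Unary
  using (Pred; _∈_; _∉_; _⊆_; _≐_; _⊥_; _≬_; ∁; ⋃; _⟨×⟩_; _⊢_)

private
  variable
    ℓ c : Level

-- Real numbers as open lower Dedekind cuts of ℚ. Without excluded middle these
-- are only the lower reals; with it, they are the usual real numbers.

record ℝ : Set₁ where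
  field
    cut       : Pred ℚ 0ℓ
    inhabited : ∃[ q ] q ∈ cut
    bounded   : ∃[ q ] q ∉ cut
    down      : ∀ {p q} → p ℚ.< q → q ∈ cut → p ∈ cut
    open′     : ∀ {q} → q ∈ cut → ∃[ r ] (q ℚ.< r × r ∈ cut)

open ℝ

infix 4 _≈ᴿ_ _≤ᴿ_ _<ᴿ_

_≈ᴿ_ _≤ᴿ_ _<ᴿ_ : Rel ℝ 0ℓ
x ≈ᴿ y = cut x ≐ cut y
x ≤ᴿ y = cut x ⊆ cut y
x <ᴿ y = ∃[ q ] (q ∉ cut x × q ∈ cut y)

0ᴿ : ℝ
0ᴿ .cut q     = q ℚ.< ℚ.0ℚ
0ᴿ .inhabited = ℚ.- ℚ.1ℚ , ℚ.negative⁻¹ (ℚ.- ℚ.1ℚ)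
0ᴿ .bounded   = ℚ.0ℚ , ℚ.<-irrefl refl
0ᴿ .down      = ℚ.<-trans
0ᴿ .open′     = ℚ.<-dense

private
  below : ∀ x {a m} → a ∈ cut x → m ∉ cut x → a ℚ.< m
  below x {a} {m} a∈x m∉x with a ℚ.<? m
  ... | yes a<m = a<m
  ... | no  a≮m with m ℚ.≟ a
  ...   | yes m≡a = contradiction (subst (_∈ cut x) (sym m≡a) a∈x) m∉x
  ...   | no  m≢a = contradiction (down x (ℚ.≰⇒> λ a≤m → m≢a (ℚ.≤-antisym (ℚ.≮⇒≥ a≮m) a≤m)) a∈x) m∉x

infixl 6 _+ᴿ_

-- Since cuts are open, this is the cut { a + b ∣ a ∈ x , b ∈ y }.

_+ᴿ_ : ℝ → ℝ → ℝ
(x +ᴿ y) .cut q = ∃[ a ] ∃[ b ] (a ∈ cut x × b ∈ cut y × q ℚ.< a ℚ.+ b)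
(x +ᴿ y) .inhabited with inhabited x | inhabited y
... | a , a∈x | b , b∈y with open′ x a∈x | open′ y b∈y
...   | a′ , a<a′ , a′∈x | b′ , b<b′ , b′∈y =
  a ℚ.+ b , a′ , b′ , a′∈x , b′∈y , ℚ.+-mono-< a<a′ b<b′
(x +ᴿ y) .bounded with bounded x | bounded y
... | m , m∉x | n , n∉y = m ℚ.+ n , λ (a , b , a∈x , b∈y , m+n<a+b) →
  ℚ.<-asym m+n<a+b (ℚ.+-mono-< (below x a∈x m∉x) (below y b∈y n∉y))
(x +ᴿ y) .down p<q (a , b , a∈x , b∈y , q<a+b) = a , b , a∈x , b∈y , ℚ.<-trans p<q q<a+b
(x +ᴿ y) .open′ (a , b , a∈x , b∈y , q<a+b) with ℚ.<-dense q<a+b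
... | r , q<r , r<a+b = r , q<r , a , b , a∈x , b∈y , r<a+b

-- The σ-algebra generated by 𝒞. Closure under _≐_ expresses that subsets are
-- taken up to extensional equality.

data σ⟨_⟩ {X : Set ℓ} (𝒞 : Pred (Pred X ℓ) c) : Pred (Pred X ℓ) (suc ℓ ⊔ c) where
  generator  : ∀ {A} → A ∈ 𝒞 → A ∈ σ⟨ 𝒞 ⟩
  whole      : (λ _ → ⊤) ∈ σ⟨ 𝒞 ⟩
  complement : ∀ {A} → A ∈ σ⟨ 𝒞 ⟩ → ∁ A ∈ σ⟨ 𝒞 ⟩
  union      : ∀ {A : ℕ → Pred X ℓ} → (∀ n → A n ∈ σ⟨ 𝒞 ⟩) → ⋃ ℕ A ∈ σ⟨ 𝒞 ⟩
  resp       : ∀ {A B} → A ≐ B → A ∈ σ⟨ 𝒞 ⟩ → B ∈ σ⟨ 𝒞 ⟩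

module _ {X : Set ℓ} where

  Countable : Pred (Pred X ℓ) ℓ
  Countable D = Σ[ f ∈ (X → ℕ) ] (∀ {x y} → x ∈ D → y ∈ D → f x ≡ f y → x ≡ y)

  module _ (d : X → X → ℝ) where

    Ball : X → ℝ → Pred X 0ℓ
    Ball x ε y = d x y <ᴿ ε

    Open : Pred (Pred X ℓ) (suc 0ℓ ⊔ ℓ)
    Open V = ∀ {x} → x ∈ V → ∃[ ε ] (0ᴿ <ᴿ ε × Ball x ε ⊆ V)

    Dense : Pred (Pred X ℓ) (suc 0ℓ ⊔ ℓ)
    Dense D = ∀ x ε → 0ᴿ <ᴿ ε → D ≬ Ball x ε

    Cauchy : Pred (ℕ → X) (suc 0ℓ)
    Cauchy s = ∀ ε → 0ᴿ <ᴿ ε → ∃[ N ] (∀ m n → N ℕ.≤ m → N ℕ.≤ n → d (s m) (s n) <ᴿ ε)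

    infix 4 _⟶_

    _⟶_ : (ℕ → X) → X → Set₁
    s ⟶ x = ∀ ε → 0ᴿ <ᴿ ε → ∃[ N ] (∀ n → N ℕ.≤ n → d (s n) x <ᴿ ε)

    record IsPolishMetric : Set (suc (suc 0ℓ ⊔ ℓ)) where
      field
        isMetric  : IsGeneralMetric _≡_ _≈ᴿ_ _≤ᴿ_ 0ᴿ _+ᴿ_ d
        complete  : ∀ s → Cauchy s → ∃[ x ] s ⟶ x
        separable : ∃[ D ] (Countable D × Dense D)

record StandardBorelSpace ℓ : Set (suc (suc ℓ)) where
  field
    Carrier    : Set ℓ
    Borel      : Pred (Pred Carrier ℓ) (suc ℓ)
    isStandard : Σ[ d ∈ (Carrier → Carrier → ℝ) ]
                   (IsPolishMetric d × (∀ A → A ∈ Borel ⇔ A ∈ σ⟨ Open d ⟩))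

CountablyInfinite : Group ℓ ℓ → Set ℓ
CountablyInfinite G = Bijection (setoid ℕ) (Group.setoid G)

record BorelGSpace (G : Group ℓ ℓ) : Set (suc (suc ℓ)) where
  open Group G using (_≈_; _∙_; ε) renaming (Carrier to |G|)

  field
    space : StandardBorelSpace ℓ

  open StandardBorelSpace space public renaming (Carrier to X)

  -- Generators of the product of the discrete Borel structure on G with that of
  -- X; a subset of the setoid G is a predicate respecting _≈_.
  Rectangle : Pred (Pred (|G| × X) ℓ) (suc ℓ)
  Rectangle R = Σ[ S ∈ Pred |G| ℓ ] Σ[ B ∈ Pred X ℓ ]
    (S Respects _≈_ × B ∈ Borel × R ≐ (S ⟨×⟩ B))

  infixr 7 _·_ _·ˢ_

  field
    _·_      : |G| → X → X
    ·-cong   : ∀ {g h} → g ≈ h → ∀ x → g · x ≡ h · x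
    identity : ∀ x → ε · x ≡ x
    compat   : ∀ g h x → (g ∙ h) · x ≡ g · h · x
    borel    : ∀ {A} → A ∈ Borel → uncurry _·_ ⊢ A ∈ σ⟨ Rectangle ⟩

  _·ˢ_ : |G| → Pred X ℓ → Pred X ℓ
  (g ·ˢ A) y = ∃[ x ] (x ∈ A × y ≡ g · x)

  Orbit : X → Pred X ℓ
  Orbit x y = ∃[ g ] y ≡ g · x

  CompleteSection : Pred (Pred X ℓ) ℓ
  CompleteSection A = ∀ x → A ≬ Orbit x

  Finite : Pred (Pred |G| ℓ) ℓ
  Finite H = Σ[ gs ∈ List |G| ] (∀ {h} → h ∈ H → Any (h ≈_) gs)

  WeaklyWandering : Pred (Pred X ℓ) (suc ℓ)
  WeaklyWandering A = Σ[ H ∈ Pred |G| ℓ ]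
    (H Respects _≈_ × ¬ Finite H ×
     (∀ {h h′} → h ∈ H → h′ ∈ H → ¬ (h ≈ h′) → (h ·ˢ A) ⊥ (h′ ·ˢ A)))

  Translates : ∀ {k} → (Fin k → Pred X ℓ) → Pred (Pred X ℓ) ℓ
  Translates A B = ∃[ g ] ∃[ n ] B ≐ g ·ˢ A n

  record Generator (k : ℕ) : Set (suc ℓ) where
    field
      piece     : Fin k → Pred X ℓ
      isBorel   : ∀ n → piece n ∈ Borel
      disjoint  : ∀ {m n} → m ≢ n → piece m ⊥ piece n
      cover     : ∀ x → ∃[ n ] x ∈ piece n
      generates : ∀ B → B ∈ Borel ⇔ B ∈ σ⟨ Translates piece ⟩

{-# OPTIONS --safe #-}

-- Let W be the complete section, let h₀, h₁, … be distinct group elements with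
-- pairwise disjoint translates hₙW, and let U₀, U₁, … be a countable base of X.
-- Code the base into a single set, C = ⋃ₙ hₙ₊₁(W ∩ Uₙ), which is disjoint from h₀W,
-- and take the pieces h₀W, C and the rest. Then W ∩ Uₙ = W ∩ hₙ₊₁⁻¹C lies in the
-- invariant σ-algebra generated by the pieces, hence so does W ∩ B for every Borel
-- B. As W meets every orbit, B is the countable union of the sets g⁻¹(W ∩ gB).

module Submission where

open import Defs
open import Algebra.Bundles using (Group)
open import Axiom.ExcludedMiddle using (ExcludedMiddle)
open import Data.Fin using (Fin; zero; suc)
open import Data.Integer using (+_; -[1+_])
open import Data.List using (List; []; _∷_)
open import Data.List.Relation.Unary.Any using (Any; here; there)
open import Data.Nat as ℕ using (ℕ; zero; suc)
import Data.Nat.Properties as ℕ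
open import Data.Product using (∃-syntax; _×_; _,_; proj₁; proj₂)
open import Data.Rational as ℚ using (ℚ; mkℚ; 0ℚ; ½)
import Data.Rational.Properties as ℚ
open import Data.Sum using (inj₁; inj₂; [_,_]′)
open import Function using (_∘_; id)
open import Function.Bundles using (mk⇔; module Equivalence; module Bijection)
open import Function.Metric.Structures using (module IsGeneralMetric)
open import Level using (Level)
open import Relation.Binary.Definitions using (tri<; tri≈; tri>)
open import Relation.Binary.PropositionalEquality
  using (_≡_; _≢_; refl; sym; trans; cong; subst; module ≡-Reasoning)
open import Relation.Nullary using (¬_; contradiction; yes; no)
open import Relation.Nullary.Decidable using (decidable-stable)
open import Relation.Unary
  using (Pred; _∈_; _∉_; _⊆_; _≐_; _⊥_; _∩_; _∪_; ∁; ⋃; _⊢_)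

open ℝ

private
  variable
    ℓ c c′ : Level

-- Cantor's enumeration of ℕ × ℕ, along the antidiagonals.

next : ℕ × ℕ → ℕ × ℕ
next (a , zero)  = zero , suc a
next (a , suc b) = suc a , b

unpair : ℕ → ℕ × ℕ
unpair zero    = zero , zero
unpair (suc n) = next (unpair n)

unpair-surjective : ∀ a b → ∃[ n ] unpair n ≡ (a , b)
unpair-surjective a b = onDiagonal (a ℕ.+ b) a b refl
  where
  onDiagonal : ∀ s a b → a ℕ.+ b ≡ s → ∃[ n ] unpair n ≡ (a , b)
  onDiagonal zero    zero    zero    _  = zero , refl
  onDiagonal (suc s) zero    (suc b) eq with onDiagonal s b zero (trans (ℕ.+-identityʳ b) (ℕ.suc-injective eq))
  ... | n , n↦ = suc n , cong next n↦
  onDiagonal s       (suc a) b       eq with onDiagonal s a (suc b) (trans (ℕ.+-suc a b) eq)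
  ... | n , n↦ = suc n , cong next n↦

-- Rational radii for balls.

rational : ℕ → ℚ
rational n = let a , b = unpair n in + a ℚ./ suc b

rational-surjective : ∀ q → 0ℚ ℚ.< q → ∃[ n ] rational n ≡ q
rational-surjective q@(mkℚ (+ a) b _) _ with unpair-surjective a b
-- `mkℚ` stores the denominator minus one, so the field `b` is already the second coordinate to be
-- coded.
... | n , n↦ = n , trans (cong (λ (a , b) → + a ℚ./ suc b) n↦) (ℚ.↥p/↧p≡p q)
rational-surjective q@(mkℚ -[1+ _ ] _ _) 0<q =
  contradiction 0<q (ℚ.<-asym (ℚ.negative⁻¹ q))

½p+½p≡p : ∀ p → ½ ℚ.* p ℚ.+ ½ ℚ.* p ≡ p
½p+½p≡p p = trans (sym (ℚ.*-distribʳ-+ p ½ ½)) (ℚ.*-identityˡ p)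

½p-positive : ∀ {p} → 0ℚ ℚ.< p → 0ℚ ℚ.< ½ ℚ.* p
½p-positive = ℚ.*-monoʳ-<-pos ½

-- Rational bounds on cuts.

fromℚ : ℚ → ℝ
fromℚ q .cut p     = p ℚ.< q
fromℚ q .inhabited = q ℚ.+ ℚ.- ℚ.1ℚ ,
  subst (q ℚ.+ ℚ.- ℚ.1ℚ ℚ.<_) (ℚ.+-identityʳ q) (ℚ.+-monoʳ-< q (ℚ.negative⁻¹ (ℚ.- ℚ.1ℚ)))
fromℚ q .bounded   = q , ℚ.<-irrefl refl
fromℚ q .down      = ℚ.<-trans
fromℚ q .open′     = ℚ.<-dense

∈-∉⇒< : ∀ x {p q} → p ∈ cut x → q ∉ cut x → p ℚ.< q
∈-∉⇒< x {p} {q} p∈x q∉x with ℚ.<-cmp p q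
... | tri< p<q _ _  = p<q
... | tri≈ _ refl _ = contradiction p∈x q∉x
... | tri> _ _ q<p  = contradiction (down x q<p p∈x) q∉x

-- Non-membership `p ∉ cut x` reads x ≤ p, so rational upper bounds add. Composed with `triangle`,
-- this bounds a distance by a sum of two rationals.
+-∉ : ∀ x y {p q} → p ∉ cut x → q ∉ cut y → p ℚ.+ q ∉ cut (x +ᴿ y)
+-∉ x y p∉x q∉y (a , b , a∈x , b∈y , p+q<a+b) =
  ℚ.<-asym p+q<a+b (ℚ.+-mono-< (∈-∉⇒< x a∈x p∉x) (∈-∉⇒< y b∈y q∉y))

-- A countable base of a Polish metric space.

module _ {X : Set ℓ} {d : X → X → ℝ} (polish : IsPolishMetric d) where

  open IsPolishMetric polish
  open IsGeneralMetric isMetric using (triangle) renaming (sym to d-sym)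

  D : Pred X _
  D = proj₁ separable

  index : X → ℕ
  index = proj₁ (proj₁ (proj₂ separable))

  index-injective : ∀ {x y} → x ∈ D → y ∈ D → index x ≡ index y → x ≡ y
  index-injective = proj₂ (proj₁ (proj₂ separable))

  dense : Dense d D
  dense = proj₂ (proj₂ separable)

  -- n codes the index of a centre in D and a radius; radius 0 gives the empty set.

  base : ℕ → Pred X ℓ
  base n y = let i , r = unpair n in
    ∃[ x ] (x ∈ D × index x ≡ i × y ∈ Ball d x (fromℚ (rational r)))

  base-open : ∀ n → Open d (base n)
  base-open n {y} (x , x∈D , x↦i , s , s∉dxy , s<q) =
    -- The witness `s` satisfies d(x,y) ≤ s < q, so by the triangle inequality the ball of radius q
    -- - s about `y` stays inside the ball of radius q about `x`.
    fromℚ (q ℚ.- s) ,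
    (0ℚ , ℚ.<-irrefl refl , subst (ℚ._< q ℚ.- s) (ℚ.+-inverseʳ s) (ℚ.+-monoˡ-< (ℚ.- s) s<q)) ,
    λ {z} (t , t∉dyz , t<q-s) → x , x∈D , x↦i , s ℚ.+ t ,
      +-∉ (d x y) (d y z) s∉dxy t∉dyz ∘ triangle x y z ,
      subst (s ℚ.+ t ℚ.<_) s+[q-s]≡q (ℚ.+-monoʳ-< s t<q-s)
    where
    q = rational (proj₂ (unpair n))

    s+[q-s]≡q : s ℚ.+ (q ℚ.- s) ≡ q
    s+[q-s]≡q = begin
      s ℚ.+ (q ℚ.- s)        ≡⟨ ℚ.+-comm s _ ⟩
      (q ℚ.- s) ℚ.+ s        ≡⟨ ℚ.+-assoc q (ℚ.- s) s ⟩
      q ℚ.+ (ℚ.- s ℚ.+ s)    ≡⟨ cong (q ℚ.+_) (ℚ.+-inverseˡ s) ⟩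
      q ℚ.+ 0ℚ               ≡⟨ ℚ.+-identityʳ q ⟩
      q                      ∎
      where open ≡-Reasoning

  -- Pick a positive rational `p′` below the radius `ε` and a centre `y` in `D` closer than p′/2 to
  -- `x`. The ball of radius p′/2 about `y` contains `x` and lies within distance p′ of it.
  base-isBase : ∀ {V} → Open d V → ∀ {x} → x ∈ V → ∃[ n ] (x ∈ base n × base n ⊆ V)
  base-isBase {V} V-open {x} x∈V
    with ε , (p , p≮0 , p∈ε) , ball⊆V ← V-open x∈V
    -- The witness `p` may be 0; openness of the cut supplies a larger, hence positive, one.
    with p′ , p<p′ , p′∈ε ← open′ ε p∈ε
    with 0<q ← ½p-positive (ℚ.≤-<-trans (ℚ.≮⇒≥ p≮0) p<p′)
    with y , y∈D , s , s∉dxy , s<q ← dense x (fromℚ (½ ℚ.* p′)) (0ℚ , ℚ.<-irrefl refl , 0<q)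
    with r , r↦q ← rational-surjective (½ ℚ.* p′) 0<q
    with n , n↦ ← unpair-surjective (index y) r
    = n , x∈base , base⊆V
    where
    q≡ : rational (proj₂ (unpair n)) ≡ ½ ℚ.* p′
    q≡ = trans (cong (rational ∘ proj₂) n↦) r↦q

    x∈base : x ∈ base n
    x∈base = y , y∈D , sym (cong proj₁ n↦) , s , s∉dxy ∘ proj₁ (d-sym y x) ,
      subst (s ℚ.<_) (sym q≡) s<q

    base⊆V : base n ⊆ V
    base⊆V {z} (y′ , y′∈D , y′↦ , t , t∉dy′z , t<q)
      -- The code records only the index of the centre, and injectivity on `D` recovers the centre.
      with refl ← index-injective y′∈D y∈D (trans y′↦ (cong proj₁ n↦)) =
      ball⊆V (s ℚ.+ t , +-∉ (d x y) (d y z) s∉dxy t∉dy′z ∘ triangle x y z ,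
        down ε (subst (s ℚ.+ t ℚ.<_) (½p+½p≡p p′) (ℚ.+-mono-< s<q (subst (t ℚ.<_) q≡ t<q))) p′∈ε)

-- Generated σ-algebras and preimages.

preimage : ∀ {X Y : Set ℓ} {𝒞 : Pred (Pred Y ℓ) c} {𝒟 : Pred (Pred X ℓ) c′} (f : X → Y) →
  (∀ {A} → A ∈ 𝒞 → f ⊢ A ∈ σ⟨ 𝒟 ⟩) → ∀ {A} → A ∈ σ⟨ 𝒞 ⟩ → f ⊢ A ∈ σ⟨ 𝒟 ⟩
preimage f f⊢𝒞 (generator A∈𝒞) = f⊢𝒞 A∈𝒞
preimage f f⊢𝒞 whole = whole
preimage f f⊢𝒞 (complement A∈σ) = complement (preimage f f⊢𝒞 A∈σ)
preimage f f⊢𝒞 (union A∈σ) = union (preimage f f⊢𝒞 ∘ A∈σ)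
preimage f f⊢𝒞 (resp (A⊆B , B⊆A) A∈σ) = resp (A⊆B , B⊆A) (preimage f f⊢𝒞 A∈σ)

module _ {X : Set ℓ} {𝒞 : Pred (Pred X ℓ) c} where

  ∪-σ : ∀ {A B} → A ∈ σ⟨ 𝒞 ⟩ → B ∈ σ⟨ 𝒞 ⟩ → A ∪ B ∈ σ⟨ 𝒞 ⟩
  ∪-σ {A} {B} A∈σ B∈σ = resp (to , from) (union {A = sets} λ where
      zero    → A∈σ
      (suc _) → B∈σ)
    where
    sets : ℕ → Pred X ℓ
    sets zero    = A
    sets (suc _) = B

    to : ⋃ ℕ sets ⊆ A ∪ B
    to (zero  , x∈A) = inj₁ x∈A
    to (suc _ , x∈B) = inj₂ x∈B

    from : A ∪ B ⊆ ⋃ ℕ sets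
    from = [ (zero ,_) , (1 ,_) ]′

Range : ∀ {X : Set ℓ} → (ℕ → Pred X ℓ) → Pred (Pred X ℓ) (Level.suc ℓ)
Range U A = ∃[ n ] A ≡ U n

-- Translates and the invariant σ-algebra they generate.

module Action {G : Group ℓ ℓ} (X : BorelGSpace G) where

  open Group G using (_∙_; ε; _⁻¹; inverseˡ; inverseʳ) renaming (Carrier to |G|)
  open BorelGSpace X renaming (X to |X|)

  ·-inverseˡ : ∀ g x → g ⁻¹ · g · x ≡ x
  ·-inverseˡ g x = trans (sym (compat _ g x)) (trans (·-cong (inverseˡ g) x) (identity x))

  ·-inverseʳ : ∀ g x → g · g ⁻¹ · x ≡ x
  ·-inverseʳ g x = trans (sym (compat g _ x)) (trans (·-cong (inverseʳ g) x) (identity x))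

  ·-injective : ∀ g {x y} → g · x ≡ g · y → x ≡ y
  ·-injective g {x} {y} gx≡gy =
    trans (sym (·-inverseˡ g x)) (trans (cong (g ⁻¹ ·_) gx≡gy) (·-inverseˡ g y))

  ·ˢ-mono : ∀ g {A B} → A ⊆ B → g ·ˢ A ⊆ g ·ˢ B
  ·ˢ-mono g A⊆B (x , x∈A , y≡gx) = x , A⊆B x∈A , y≡gx

  ·ˢ-preimage : ∀ g A → ((g ⁻¹ ·_) ⊢ A) ≐ g ·ˢ A
  ·ˢ-preimage g A = (λ {y} a → g ⁻¹ · y , a , sym (·-inverseʳ g y)) ,
    λ { (x , a , refl) → subst A (sym (·-inverseˡ g x)) a }

  preimage-·ˢ : ∀ g h A → ((g ⁻¹ ∙ h) ·ˢ A) ≐ ((g ·_) ⊢ (h ·ˢ A))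
  preimage-·ˢ g h A =
    (λ { (x , a , refl) → x , a , trans (cong (g ·_) (compat (g ⁻¹) h x)) (·-inverseʳ g _) }) ,
    λ {y} (x , a , gy≡hx) → x , a ,
      trans (sym (·-inverseˡ g y)) (trans (cong (g ⁻¹ ·_) gy≡hx) (sym (compat (g ⁻¹) h x)))

  -- Minimality of a generated σ-algebra: `preimage` along `id` exchanges one family of generators
  -- for another.
  σ⇒Borel : ∀ {c} {𝒞 : Pred (Pred |X| ℓ) c} → 𝒞 ⊆ Borel → σ⟨ 𝒞 ⟩ ⊆ Borel
  σ⇒Borel 𝒞⊆Borel A∈σ = let _ , _ , Borel⇔σ = isStandard in
    Equivalence.from (Borel⇔σ _) (preimage id (Equivalence.to (Borel⇔σ _) ∘ 𝒞⊆Borel) A∈σ)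

  module _ {k} (A : Fin k → Pred |X| ℓ) where

    -- Pulling the generator hAₙ back along g gives the generator (g⁻¹h)Aₙ, so the σ-algebra is
    -- invariant.
    translates-preimage : ∀ g {B} → B ∈ σ⟨ Translates A ⟩ → (g ·_) ⊢ B ∈ σ⟨ Translates A ⟩
    translates-preimage g = preimage (g ·_) λ (h , n , B⊆hA , hA⊆B) →
      let to , from = preimage-·ˢ g h (A n)
      in generator (g ⁻¹ ∙ h , n , from ∘ B⊆hA , hA⊆B ∘ to)

    translates-σ : ∀ g n → g ·ˢ A n ∈ σ⟨ Translates A ⟩
    translates-σ g n = generator (g , n , id , id)

    -- As g acts injectively, `B` is the preimage of gB under g.
    translates-⁻¹-σ : ∀ g {B} → g ·ˢ B ∈ σ⟨ Translates A ⟩ → B ∈ σ⟨ Translates A ⟩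
    translates-⁻¹-σ g {B} gB∈σ = resp
      ((λ { {y} (x , b , gy≡gx) → subst B (sym (·-injective g gy≡gx)) b }) , λ b → _ , b , refl)
      (translates-preimage g gB∈σ)

-- Classical closure properties of σ-algebras.

module _ (em : ExcludedMiddle ℓ) where

  module _ {X : Set ℓ} {𝒞 : Pred (Pred X ℓ) c} where

    ∩-σ : ∀ {A B} → A ∈ σ⟨ 𝒞 ⟩ → B ∈ σ⟨ 𝒞 ⟩ → A ∩ B ∈ σ⟨ 𝒞 ⟩
    ∩-σ A∈σ B∈σ = resp
      ( (λ ¬[¬a∪¬b] → decidable-stable em (¬[¬a∪¬b] ∘ inj₁) , decidable-stable em (¬[¬a∪¬b] ∘ inj₂))
      , (λ (a , b) → [ contradiction a , contradiction b ]′))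
      (complement (∪-σ (complement A∈σ) (complement B∈σ)))

    -- Once `P` is decided, the set is `A` or empty. This lets a union over all of ℕ range only over
    -- the indices that satisfy a condition.
    guard-σ : ∀ (P : Set ℓ) {A} → A ∈ σ⟨ 𝒞 ⟩ → (λ x → P × x ∈ A) ∈ σ⟨ 𝒞 ⟩
    guard-σ P A∈σ with em {P}
    ... | yes p = resp ((p ,_) , proj₂) A∈σ
    ... | no ¬p = resp ((λ ¬⊤ → contradiction _ ¬⊤) , λ (p , _) → contradiction p ¬p) (complement whole)

  -- Induction on the generation of `A`. In the complement case, W ∖ A is W ∩ ∁(W ∩ A), which needs
  -- only the trace of `A`.
  trace : ∀ {X : Set ℓ} {𝒞 : Pred (Pred X ℓ) c} {𝒟 : Pred (Pred X ℓ) c′} {W} → W ∈ σ⟨ 𝒟 ⟩ →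
    (∀ {A} → A ∈ 𝒞 → W ∩ A ∈ σ⟨ 𝒟 ⟩) → ∀ {A} → A ∈ σ⟨ 𝒞 ⟩ → W ∩ A ∈ σ⟨ 𝒟 ⟩
  trace W∈σ W∩𝒞 (generator A∈𝒞)  = W∩𝒞 A∈𝒞
  trace W∈σ W∩𝒞 whole            = ∩-σ W∈σ whole
  trace W∈σ W∩𝒞 (complement A∈σ) = resp
    ((λ (w , ¬wa) → w , λ a → ¬wa (w , a)) , λ (w , ¬a) → w , ¬a ∘ proj₂)
    (∩-σ W∈σ (complement (trace W∈σ W∩𝒞 A∈σ)))
  trace W∈σ W∩𝒞 (union A∈σ)      = resp
    ((λ (n , w , a) → w , n , a) , λ (w , n , a) → n , w , a)
    (union (trace W∈σ W∩𝒞 ∘ A∈σ))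
  trace W∈σ W∩𝒞 (resp (A⊆B , B⊆A) A∈σ) = resp
    ((λ (w , a) → w , A⊆B a) , λ (w , b) → w , B⊆A b)
    (trace W∈σ W∩𝒞 A∈σ)

  -- An open set is the union of the basic sets it contains; `guard-σ` discards the others.
  open⇒base-σ : ∀ {X : Set ℓ} {d : X → X → ℝ} (polish : IsPolishMetric d) →
    ∀ {V} → Open d V → V ∈ σ⟨ Range (base polish) ⟩
  open⇒base-σ polish {V} V-open = resp
    ( (λ (n , Uₙ⊆V , x∈Uₙ) → Uₙ⊆V x∈Uₙ)
    , (λ x∈V → let n , x∈Uₙ , Uₙ⊆V = base-isBase polish V-open x∈V
               in n , (λ {y} → Uₙ⊆V {y}) , x∈Uₙ))
    (union λ n → guard-σ (base polish n ⊆ V) (generator (n , refl)))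

  module _ {G : Group ℓ ℓ} (X : BorelGSpace G) where

    open Group G using (_≈_; ε; _⁻¹) renaming (Carrier to |G|)
    open BorelGSpace X renaming (X to |X|)
    open Action X

    -- The action is jointly measurable, and the section at g of a rectangle S × B is `B` or empty
    -- according to whether g lies in `S`.
    preimage-Borel : ∀ g {A} → A ∈ Borel → (g ·_) ⊢ A ∈ Borel
    preimage-Borel g A∈Borel = σ⇒Borel id (preimage (g ,_) section (borel A∈Borel))
      where
      section : ∀ {R} → R ∈ Rectangle → (g ,_) ⊢ R ∈ σ⟨ Borel ⟩
      section (S , B , _ , B∈Borel , R⊆S×B , S×B⊆R) =
        resp (S×B⊆R , R⊆S×B) (guard-σ (S g) (generator B∈Borel))

    ·ˢ-Borel : ∀ g {A} → A ∈ Borel → g ·ˢ A ∈ Borel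
    ·ˢ-Borel g {A} A∈Borel =
      σ⇒Borel id (resp (·ˢ-preimage g A) (generator (preimage-Borel (g ⁻¹) A∈Borel)))

    countable-base : ∃[ U ] ((∀ n → U n ∈ Borel) × (∀ {A} → A ∈ Borel → A ∈ σ⟨ Range U ⟩))
    countable-base = let _ , polish , Borel⇔σ = isStandard in
      base polish ,
      (λ n → Equivalence.from (Borel⇔σ _) (generator (base-open polish n))) ,
      λ A∈Borel → preimage id (open⇒base-σ polish) (Equivalence.to (Borel⇔σ _) A∈Borel)

    -- A sequence of distinct elements in an infinite subset of the group.

    module _ {H : Pred |G| ℓ} (H-infinite : ¬ Finite H) where

      -- If there were no such element, `gs` would list all of `H`.
      fresh : ∀ gs → ∃[ h ] (h ∈ H × ¬ Any (h ≈_) gs)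
      fresh gs = decidable-stable em λ none →
        H-infinite (gs , λ h∈H → decidable-stable em λ h∉gs → none (_ , h∈H , h∉gs))

      initial : ℕ → List |G|
      initial zero    = []
      initial (suc n) = proj₁ (fresh (initial n)) ∷ initial n

      enum : ℕ → |G|
      enum n = proj₁ (fresh (initial n))

      enum∈H : ∀ n → enum n ∈ H
      enum∈H n = proj₁ (proj₂ (fresh (initial n)))

      enum-initial : ∀ {m n h} → m ℕ.< n → h ≈ enum m → Any (h ≈_) (initial n)
      enum-initial {n = suc n} m<1+n h≈ with ℕ.m<1+n⇒m<n∨m≡n m<1+n
      ... | inj₁ m<n  = there (enum-initial m<n h≈)
      ... | inj₂ refl = here h≈

      enum-distinct : ∀ {m n} → m ≢ n → ¬ (enum m ≈ enum n)
      enum-distinct {m} {n} m≢n eq with ℕ.<-cmp m n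
      ... | tri< m<n _ _ = proj₂ (proj₂ (fresh (initial n))) (enum-initial m<n (Group.sym G eq))
      ... | tri≈ _ m≡n _ = m≢n m≡n
      ... | tri> _ _ n<m = proj₂ (proj₂ (fresh (initial m))) (enum-initial n<m eq)

    -- Construction of the generator.

    module Coding (G-countable : CountablyInfinite G)
      {W} (W∈Borel : W ∈ Borel) (W-section : CompleteSection W)
      (h : ℕ → |G|) (h-wandering : ∀ {m n} → m ≢ n → (h m ·ˢ W) ⊥ (h n ·ˢ W))
      {U : ℕ → Pred |X| ℓ} (U∈Borel : ∀ n → U n ∈ Borel)
      (U-generates : ∀ {A} → A ∈ Borel → A ∈ σ⟨ Range U ⟩) where

      -- The shift to `suc n` reserves `h zero` for a piece of its own, from which `W` is recovered.
      code : Pred |X| ℓ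
      code = ⋃ ℕ λ n → h (suc n) ·ˢ (W ∩ U n)

      pieces : Fin 3 → Pred |X| ℓ
      pieces zero             = h zero ·ˢ W
      pieces (suc zero)       = code
      pieces (suc (suc zero)) = ∁ (h zero ·ˢ W ∪ code)

      section⊥code : (h zero ·ˢ W) ⊥ code
      section⊥code (y∈h₀W , n , y∈) =
        h-wandering ℕ.0≢1+n (y∈h₀W , ·ˢ-mono (h (suc n)) proj₁ y∈)

      -- If a point of the translate of `W` by `h (suc n)` lies in the `m`-th part of the code,
      -- disjointness of the translates forces m = n, and injectivity of the action identifies the
      -- two points of `W`.
      decode : ∀ n → (W ∩ ((h (suc n) ·_) ⊢ code)) ≐ (W ∩ U n)
      decode n = to , λ {x} (w , u) → w , n , x , (w , u) , refl
        where
        to : W ∩ ((h (suc n) ·_) ⊢ code) ⊆ W ∩ U n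
        to {x} (w , m , x′ , (w′ , u′) , hx≡hx′) with m ℕ.≟ n
        ... | no m≢n   = contradiction ((x′ , w′ , hx≡hx′) , x , w , refl)
                           (h-wandering (m≢n ∘ ℕ.suc-injective))
        ... | yes refl = w , subst (U n) (sym (·-injective (h (suc n)) hx≡hx′)) u′

      W∈σ : W ∈ σ⟨ Translates pieces ⟩
      -- The generator at hand is the translate of the first piece by `ε`: the inner step removes
      -- `ε`, the outer one `h zero`.
      W∈σ = translates-⁻¹-σ pieces (h zero) (translates-⁻¹-σ pieces ε (translates-σ pieces ε zero))

      code∈σ : code ∈ σ⟨ Translates pieces ⟩
      code∈σ = translates-⁻¹-σ pieces ε (translates-σ pieces ε (suc zero))

      W∩Borel∈σ : ∀ {B} → B ∈ Borel → W ∩ B ∈ σ⟨ Translates pieces ⟩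
      W∩Borel∈σ B∈Borel = trace W∈σ
        (λ { (n , refl) → resp (decode n)
          (∩-σ W∈σ (translates-preimage pieces (h (suc n)) code∈σ)) })
        (U-generates B∈Borel)

      Borel⊆σ : ∀ {B} → B ∈ Borel → B ∈ σ⟨ Translates pieces ⟩
      -- The preimage of `B` under g⁻¹ is gB, so the n-th set is g⁻¹(W ∩ gB) for the n-th group
      -- element g.
      Borel⊆σ {B} B∈Borel = resp (to , from) (union λ n →
          translates-preimage pieces (g n) (W∩Borel∈σ (preimage-Borel (g n ⁻¹) B∈Borel)))
        where
        g = Bijection.to G-countable

        to : ⋃ ℕ (λ n → (g n ·_) ⊢ (W ∩ ((g n ⁻¹ ·_) ⊢ B))) ⊆ B
        to {x} (n , _ , b) = subst B (·-inverseˡ (g n) x) b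

        from : B ⊆ ⋃ ℕ (λ n → (g n ·_) ⊢ (W ∩ ((g n ⁻¹ ·_) ⊢ B)))
        from {x} b =
          -- Some g′ moves `x` into `W`; the enumeration hits g′ only up to `≈`, hence `·-cong`
          -- below.
          let y , y∈W , g′ , y≡g′x = W-section x
              n , n↦g′             = Bijection.strictlySurjective G-countable g′
          in n , subst W (trans y≡g′x (·-cong (Group.sym G n↦g′) x)) y∈W ,
             subst B (sym (·-inverseˡ (g n) x)) b

      pieces-Borel : ∀ n → pieces n ∈ Borel
      pieces-Borel zero             = ·ˢ-Borel (h zero) W∈Borel
      pieces-Borel (suc zero)       = σ⇒Borel id (union λ n → generator
        (·ˢ-Borel (h (suc n)) (σ⇒Borel id (∩-σ (generator W∈Borel) (generator (U∈Borel n))))))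
      pieces-Borel (suc (suc zero)) = σ⇒Borel id (complement
        (∪-σ (generator (pieces-Borel zero)) (generator (pieces-Borel (suc zero)))))

      pieces-disjoint : ∀ {m n} → m ≢ n → pieces m ⊥ pieces n
      pieces-disjoint {zero}         {zero}         m≢n _       = m≢n refl
      pieces-disjoint {zero}         {suc zero}     m≢n         = section⊥code
      pieces-disjoint {zero}         {suc (suc zero)} m≢n (a , ¬a) = ¬a (inj₁ a)
      pieces-disjoint {suc zero}     {zero}         m≢n (b , a) = section⊥code (a , b)
      pieces-disjoint {suc zero}     {suc zero}     m≢n _       = m≢n refl
      pieces-disjoint {suc zero}     {suc (suc zero)} m≢n (b , ¬b) = ¬b (inj₂ b)
      pieces-disjoint {suc (suc zero)} {zero}       m≢n (¬a , a) = ¬a (inj₁ a)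
      pieces-disjoint {suc (suc zero)} {suc zero}   m≢n (¬b , b) = ¬b (inj₂ b)
      pieces-disjoint {suc (suc zero)} {suc (suc zero)} m≢n _   = m≢n refl

      pieces-cover : ∀ x → ∃[ n ] x ∈ pieces n
      pieces-cover x with em {x ∈ (h zero ·ˢ W ∪ code)}
      ... | yes (inj₁ a) = zero , a
      ... | yes (inj₂ b) = suc zero , b
      ... | no ¬a∪b      = suc (suc zero) , ¬a∪b

      generator₃ : Generator 3
      generator₃ = record
        { piece     = pieces
        ; isBorel   = pieces-Borel
        ; disjoint  = pieces-disjoint
        ; cover     = pieces-cover
        ; generates = λ B → mk⇔ Borel⊆σ (σ⇒Borel λ (g , n , B⊆gA , gA⊆B) →
            σ⇒Borel id (resp (gA⊆B , B⊆gA) (generator (·ˢ-Borel g (pieces-Borel n)))))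
        }

proposition7p2 : ∀ {ℓ} → ExcludedMiddle ℓ →
    (G : Group ℓ ℓ) → CountablyInfinite G →
    (X : BorelGSpace G) →
    ∃[ A ] (A ∈ BorelGSpace.Borel X × A ∈ BorelGSpace.WeaklyWandering X × A ∈ BorelGSpace.CompleteSection X) →
    BorelGSpace.Generator X 3
proposition7p2 em G G-countable X
  (W , W∈Borel , (H , _ , H-infinite , H-disjoint) , W-section) =
  let U , U∈Borel , U-generates = countable-base em X
      h∈H = enum∈H em X H-infinite
  in Coding.generator₃ em X G-countable W∈Borel W-section (enum em X H-infinite)
       -- Distinct indices give elements distinct for the group's own equality, as weak wandering
       -- demands.
       (λ m≢n → H-disjoint (h∈H _) (h∈H _) (enum-distinct em X H-infinite m≢n))
       U∈Borel U-generates
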